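{- Let $\Omega_1$ be the partial functional on subsets $X\subseteq\mathbb N^{\mathbb N}$ which is defined exactly when $X=\{x\}$ for some $x$, with $\Omega_1(X)=x$. Let $\Psi$ be a total and countably based functional and let $\Xi$ be a total functional of type rank $\le 3$. Then the pairs $\Psi,\Omega_1$ and $\Psi,\Xi$ are not computationally equivalent.
   Context: Types: $0$ is a type of rank $0$; if $\sigma_1,\dots,\sigma_n$ ($n\ge 1$) are types, then $(\sigma_1,\dots,\sigma_n\to 0)$ is a type of rank $\max_i(\mathrm{rank}(\sigma_i)+1)$. Put $F(0)=\mathbb N$ and let $F(\sigma_1,\dots,\sigma_n\to 0)$ be the set of all total functions $F(\sigma_1)\times\cdots\times F(\sigma_n)\to\mathbb N$. Let $P(0)=\mathbb N\cup\{\bot\}$ and let $P(\sigma_1,\dots,\sigma_n\to 0)$ be the set of all functions $F(\sigma_1)\times\cdots\times F(\sigma_n)\to\mathbb N\cup\{\bot\}$, where $\bot$ means undefined (partial functionals, applied only to total arguments). A functional is total if it never takes the value $\bot$. Functionals with values in $\mathbb N^{\mathbb N}$ are viewed as $\mathbb N$-valued functionals with an extra number argument. Sets are given by characteristic functions. Computability: Kleene's S1–S9, where partial functionals of type rank $\le 3$ are allowed as oracles. That is, $\{e\}(\vec\phi)\simeq a$ is the least relation closed under Kleene's schemes: successor, constants, projection to a number argument, composition, primitive recursion, permutation of arguments, application of an argument, and S9: $\{e\}(m,\vec\phi,\vec\psi)\simeq\{m\}(\vec\phi)$. An application $\phi_i(\lambda\vec\xi_1.\{d_1\}(\vec\xi_1,\vec\phi),\dots,\lambda\vec\xi_k.\{d_k\}(\vec\xi_k,\vec\phi))$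 has value $a\in\mathbb N$ iff all the displayed functionals are total (on total arguments) and $\phi_i$ applied to them equals $a$. A partial functional $\psi$ is computable in $\vec\phi$ if for some $e$, $\{e\}(\vec\xi,\vec\phi)\simeq\psi(\vec\xi)$ for all total $\vec\xi$ with $\psi(\vec\xi)\ne\bot$. Two pairs are computationally equivalent if each member of either pair is computable in the other pair. Countably based (total case): let $\Phi\in F(\sigma)$ with $\mathrm{rank}(\sigma)\le 3$, $\sigma=(\tau_1,\dots,\tau_n\to 0)$, $\tau_i=(\delta_{i,1},\dots,\delta_{i,m_i}\to 0)$ with all $\delta_{i,j}$ of rank $\le 1$. $\Phi$ is countably based if for all $F_1,\dots,F_n$ there are countable sets $X_i\subseteq F(\delta_{i,1})\times\cdots\times F(\delta_{i,m_i})$ such that $\Phi(F_1,\dots,F_n)=\Phi(G_1,\dots,G_n)$ whenever $F_i$ and $G_i$ are equal on $X_i$ for each $i$. (So a countably based functional is by definition of type rank $\le 3$.) -}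

module Defs where

open import Axiom.ExcludedMiddle using (ExcludedMiddle)
open import Data.Fin.Base using (Fin; zero; suc; toℕ)
open import Data.Fin.Permutation using (Permutation′; _⟨$⟩ʳ_)
open import Data.List.Base using (List; []; _∷_; _++_; length; lookup; tabulate; take)
open import Data.List.NonEmpty.Base using (List⁺; _∷_; toList)
open import Data.List.Relation.Unary.All using (All)
open import Data.Maybe.Base using (Maybe; just; nothing)
open import Data.Nat.Base using (ℕ; suc; _+_; _*_; _^_; _⊔_; _≤_)
open import Data.Product.Base using (∃; ∃-syntax; Σ-syntax; _×_; _,_)
open import Data.Unit.Base using (⊤; tt)
open import Function.Base using (_∘_)
open import Function.Bundles using (_⇔_)
open import Level using (0ℓ)
open import Relation.Binary.PropositionalEquality.Core using (_≡_)
open import Relation.Nullary.Decidable.Core using (yes; no)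
open import Relation.Nullary.Negation.Core using (¬_)
open import Relation.Unary using (Pred; _∈_; _∉_)

data Ty : Set where
  𝟘   : Ty
  _⇒𝟘 : List⁺ Ty → Ty

rank  : Ty → ℕ
ranks : List Ty → ℕ

rank 𝟘             = 0
rank ((σ ∷ σs) ⇒𝟘) = suc (rank σ) ⊔ ranks σs

ranks []       = 0
ranks (σ ∷ σs) = suc (rank σ) ⊔ ranks σs

-- Fs σs is the product F(σ₁) × ⋯ × F(σₙ); the domain F σ × Fs σs below
-- is Fs (σ ∷ σs), unfolded for the termination checker.
F  : Ty → Set
Fs : List Ty → Set

F 𝟘             = ℕ
F ((σ ∷ σs) ⇒𝟘) = F σ × Fs σs → ℕ

Fs []       = ⊤
Fs (σ ∷ σs) = F σ × Fs σs

-- nothing plays the role of ⊥.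
P : Ty → Set
P 𝟘       = Maybe ℕ
P (σs ⇒𝟘) = Fs (toList σs) → Maybe ℕ

-- Type 𝟘 is treated as having an empty list of arguments, so that a
-- number is a functional on the one-point set Fs [].
args : Ty → List Ty
args 𝟘       = []
args (σs ⇒𝟘) = toList σs

app : ∀ σ → F σ → Fs (args σ) → ℕ
app 𝟘            n _  = n
app ((_ ∷ _) ⇒𝟘) f ξs = f ξs

appP : ∀ σ → P σ → Fs (args σ) → Maybe ℕ
appP 𝟘       n _  = n
appP (_ ⇒𝟘) f ξs = f ξs

toPartial : ∀ σ → F σ → P σ
toPartial 𝟘            n = just n
toPartial ((_ ∷ _) ⇒𝟘) f = just ∘ f

component : ∀ σs → Fs σs → (i : Fin (length σs)) → F (lookup σs i)
component (σ ∷ σs) (ξ , ξs) Fin.zero    = ξ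
component (σ ∷ σs) (ξ , ξs) (Fin.suc i) = component σs ξs i

-- A (possibly partial) functional together with its type.
Arg : Set
Arg = ∃ P

num : ℕ → Arg
num n = 𝟘 , just n

total : ∀ {σ} → F σ → Arg
total {σ} f = σ , toPartial σ f

totals : ∀ {σs} → Fs σs → List Arg
totals {[]}     _        = []
totals {σ ∷ σs} (ξ , ξs) = total {σ} ξ ∷ totals {σs} ξs

-- s8 also covers Kleene's scheme S7.
data Index : Set where
  s1 s3   : Index
  s2 s9   : ℕ → Index
  s4 s5   : Index → Index → Index
  s6      : List ℕ → Index → Index
  s8      : ℕ → List Index → Index

-- Kleene's indices are natural numbers.  Here they are the numbers
-- code e; the pairing ⟪_,_⟫ is injective and never 0.
⟪_,_⟫ : ℕ → ℕ → ℕ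
⟪ m , n ⟫ = 2 ^ m * (2 * n + 1)

codeℕs : List ℕ → ℕ
codeℕs []       = 0
codeℕs (n ∷ ns) = ⟪ n , codeℕs ns ⟫

code  : Index → ℕ
codes : List Index → ℕ

code s1        = ⟪ 1 , 0 ⟫
code (s2 q)    = ⟪ 2 , q ⟫
code s3        = ⟪ 3 , 0 ⟫
code (s4 d e)  = ⟪ 4 , ⟪ code d , code e ⟫ ⟫
code (s5 d e)  = ⟪ 5 , ⟪ code d , code e ⟫ ⟫
code (s6 ns d) = ⟪ 6 , ⟪ codeℕs ns , code d ⟫ ⟫
code (s8 i ds) = ⟪ 8 , ⟪ i , codes ds ⟫ ⟫
code (s9 k)    = ⟪ 9 , k ⟫

codes []       = 0
codes (d ∷ ds) = ⟪ code d , codes ds ⟫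

permute : (φ⃗ : List Arg) → Permutation′ (length φ⃗) → List Arg
permute φ⃗ π = tabulate (λ i → lookup φ⃗ (π ⟨$⟩ʳ i))

infix 4 [_]_≃_ [_]_≃s_

-- [ e ] φ⃗ ≃ a is Kleene's {e}(φ⃗) ≃ a.  [ ds ] φ⃗ ≃s gs says that, for
-- each j, λξ⃗.{dⱼ}(ξ⃗, φ⃗) is total, with value the j-th entry of gs.
--
-- In S9 the argument list is (m, χ⃗) and χ⃗ splits as φ⃗, ψ⃗ with φ⃗ of
-- length k, i.e. φ⃗ = take k χ⃗.
data [_]_≃_  : Index → List Arg → ℕ → Set
data [_]_≃s_ : List Index → List Arg → ∀ {τs} → Fs τs → Set

data [_]_≃_ where
  S1 : ∀ {x φ⃗} → [ s1 ] num x ∷ φ⃗ ≃ suc x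
  S2 : ∀ {q φ⃗} → [ s2 q ] φ⃗ ≃ q
  S3 : ∀ {x φ⃗} → [ s3 ] num x ∷ φ⃗ ≃ x
  S4 : ∀ {d e φ⃗ b a} →
       [ e ] φ⃗ ≃ b → [ d ] num b ∷ φ⃗ ≃ a → [ s4 d e ] φ⃗ ≃ a
  S5-zero : ∀ {d e φ⃗ a} →
       [ d ] φ⃗ ≃ a → [ s5 d e ] num 0 ∷ φ⃗ ≃ a
  S5-suc : ∀ {d e x φ⃗ b a} →
       [ s5 d e ] num x ∷ φ⃗ ≃ b → [ e ] num b ∷ num x ∷ φ⃗ ≃ a →
       [ s5 d e ] num (suc x) ∷ φ⃗ ≃ a
  S6 : ∀ {ns d φ⃗ a} (π : Permutation′ (length φ⃗)) →
       ns ≡ tabulate (toℕ ∘ (π ⟨$⟩ʳ_)) →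
       [ d ] permute φ⃗ π ≃ a → [ s6 ns d ] φ⃗ ≃ a
  S8 : ∀ {i ds φ⃗ τs a} {f : P (τs ⇒𝟘)} (j : Fin (length φ⃗)) →
       i ≡ toℕ j → lookup φ⃗ j ≡ (τs ⇒𝟘 , f) →
       (gs : Fs (toList τs)) → [ ds ] φ⃗ ≃s gs → f gs ≡ just a →
       [ s8 i ds ] φ⃗ ≃ a
  S9 : ∀ {k m d χ⃗ a} →
       m ≡ code d → k ≤ length χ⃗ →
       [ d ] take k χ⃗ ≃ a → [ s9 k ] num m ∷ χ⃗ ≃ a

data [_]_≃s_ where
  []  : ∀ {φ⃗} → [ [] ] φ⃗ ≃s tt
  _∷_ : ∀ {d ds φ⃗ τ τs} {g : F τ} {gs : Fs τs} →
        (∀ (ξs : Fs (args τ)) → [ d ] totals ξs ++ φ⃗ ≃ app τ g ξs) →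
        [ ds ] φ⃗ ≃s gs →
        [ d ∷ ds ] φ⃗ ≃s (g , gs)

-- No condition is imposed where ψ is undefined.
ComputableIn : List Arg → Arg → Set
ComputableIn φ⃗ (σ , ψ) =
  ∃[ e ] (∀ (ξs : Fs (args σ)) a → appP σ ψ ξs ≡ just a →
          [ e ] totals ξs ++ φ⃗ ≃ a)

ComputationallyEquivalent : List Arg → List Arg → Set
ComputationallyEquivalent φ⃗ ψ⃗ =
  All (ComputableIn ψ⃗) φ⃗ × All (ComputableIn φ⃗) ψ⃗

-- Maybe allows the empty set to be enumerated.
Countable : {A : Set} → Pred A 0ℓ → Set
Countable {A} X = Σ[ enum ∈ (ℕ → Maybe A) ] (∀ x → x ∈ X ⇔ (∃[ n ] enum n ≡ just x))

EqualOn : ∀ {τ} → Pred (Fs (args τ)) 0ℓ → F τ → F τ → Set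
EqualOn {τ} X f g = ∀ ξs → ξs ∈ X → app τ f ξs ≡ app τ g ξs

CountablyBased : ∀ {σ} → F σ → Set₁
CountablyBased {σ} Φ = rank σ ≤ 3 ×
  (∀ (fs : Fs τs) →
     Σ[ X ∈ (∀ i → Pred (Fs (args (lookup τs i))) 0ℓ) ]
       (∀ i → Countable (X i)) ×
       (∀ (gs : Fs τs) →
          (∀ i → EqualOn (X i) (component τs fs i) (component τs gs i)) →
          app σ Φ fs ≡ app σ Φ gs))
  where τs = args σ

Baire : Ty
Baire = (𝟘 ∷ []) ⇒𝟘

-- The extra number argument makes Ω₁ ℕ-valued.
Ω₁Ty : Ty
Ω₁Ty = ((Baire ∷ []) ⇒𝟘 ∷ 𝟘 ∷ []) ⇒𝟘

CharacteristicOf : {A : Set} → Pred A 0ℓ → (A → ℕ) → Set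
CharacteristicOf S χ = ∀ x → (x ∈ S → χ x ≡ 1) × (x ∉ S → χ x ≡ 0)

IsSingleton : F ((Baire ∷ []) ⇒𝟘) → F Baire → Set
IsSingleton X x = CharacteristicOf (_≡ x) (λ y → X (y , tt))

-- X is (the characteristic function of) {x} for at most one x, so the
-- choice of x made by em does not matter.  A functional X that is not a
-- characteristic function is outside the domain.
Ω₁ : ExcludedMiddle 0ℓ → P Ω₁Ty
Ω₁ em (X , n , tt) with em {∃[ x ] IsSingleton X x}
... | yes (x , _) = just (x (n , tt))
... | no _        = nothing

{-# OPTIONS --safe #-}
module Submission where

-- A convergent computation depends on its arguments of rank ≤ 2 through
-- countably many values only, provided the other oracles are countably
-- based functionals or Ω₁: if {x} and {x′} agree at the point x, then
-- x = x′.  Hence Ξ, being computable in Ψ and Ω₁, is countably based.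
-- When all oracles are total, divergence depends on countably many values
-- as well: a divergent computation has an infinite path of divergent
-- subcomputations, which are still called, with the same oracle answers,
-- after any change of the arguments off a countable set.  Consequently an
-- algorithm for Ω₁ relative to Ψ and Ξ behaves on {x} as on ∅ for all x
-- outside a countable set, and cannot return x.

open import Axiom.ExcludedMiddle using (ExcludedMiddle)
open import Axiom.Extensionality.Propositional using (Extensionality)
open import Data.Empty using (⊥-elim)
open import Data.Fin.Base using (Fin; zero; suc; toℕ)
open import Data.Fin.Permutation using (Permutation′; _⟨$⟩ʳ_)
open import Data.Fin.Properties using (toℕ-injective)
open import Data.List.Base using (List; []; _∷_; _++_; length; lookup; tabulate; take)
open import Data.List.NonEmpty.Base using (_∷_; toList)
open import Data.List.Relation.Binary.Pointwise.Base using (Pointwise; []; _∷_)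
open import Data.List.Relation.Binary.Pointwise using (Pointwise-length; ++⁺; tabulate⁺)
  renaming (map to Pointwise-map)
open import Data.List.Relation.Unary.All using (All; []; _∷_)
open import Data.List.Relation.Unary.All.Properties using ()
  renaming (++⁺ to All-++⁺; take⁺ to All-take⁺)
open import Data.Maybe.Base as Maybe using (Maybe; just; nothing)
open import Data.Maybe.Properties using (just-injective)
open import Data.Nat.Base using (ℕ; zero; suc; _+_; _*_; _^_; _≤_; z≤n; s≤s)
open import Data.Nat.Properties
  using (m⊔n≤o⇒m≤o; m⊔n≤o⇒n≤o; *-cancelˡ-≡; *-assoc; +-cancelʳ-≡; +-identityʳ; +-comm;
         1+n≢n; m≤n⇒m≤1+n; even≢odd)
open import Data.Product.Base using (∃; ∃-syntax; Σ-syntax; _×_; _,_; proj₁; proj₂; uncurry)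
open import Data.Sum.Base using (_⊎_; inj₁; inj₂)
open import Data.Unit.Base using (⊤; tt)
open import Function.Base using (_∘_)
open import Function.Bundles using (module Equivalence)
open import Level using (0ℓ)
open import Relation.Binary.PropositionalEquality
  using (_≡_; _≢_; refl; sym; trans; cong; cong₂; subst)
open import Relation.Nullary.Decidable.Core using (Dec; yes; no)
open import Relation.Nullary.Negation.Core using (¬_; contradiction)
open import Relation.Unary using (Pred; U; _∈_; _⊆_)
open import Defs

-- Injectivity of the coding

-- By induction on the exponents: an odd number is never even, and a common factor 2 cancels.
⟪⟫-injective : ∀ m n m′ n′ → ⟪ m , n ⟫ ≡ ⟪ m′ , n′ ⟫ → m ≡ m′ × n ≡ n′
⟪⟫-injective zero n zero n′ eq =
  refl , *-cancelˡ-≡ n n′ 2 (+-cancelʳ-≡ 1 (2 * n) (2 * n′)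
    (trans (sym (+-identityʳ (2 * n + 1))) (trans eq (+-identityʳ (2 * n′ + 1)))))
⟪⟫-injective zero n (suc m′) n′ eq =
  ⊥-elim (even≢odd ⟪ m′ , n′ ⟫ n (sym (trans (trans (+-comm 1 (2 * n)) (sym (+-identityʳ (2 * n + 1))))
                                        (trans eq (*-assoc 2 (2 ^ m′) (2 * n′ + 1))))))
⟪⟫-injective (suc m) n zero n′ eq with ⟪⟫-injective zero n′ (suc m) n (sym eq)
... | ()
⟪⟫-injective (suc m) n (suc m′) n′ eq
  with ⟪⟫-injective m n m′ n′ (*-cancelˡ-≡ ⟪ m , n ⟫ ⟪ m′ , n′ ⟫ 2
         (trans (sym (*-assoc 2 (2 ^ m) (2 * n + 1))) (trans eq (*-assoc 2 (2 ^ m′) (2 * n′ + 1)))))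
... | refl , n≡n′ = refl , n≡n′

⟪⟫≢0 : ∀ m n → ⟪ m , n ⟫ ≢ 0
⟪⟫≢0 zero    n eq with trans (+-comm 1 (2 * n)) (trans (sym (+-identityʳ (2 * n + 1))) eq)
... | ()
⟪⟫≢0 (suc m) n eq =
  ⟪⟫≢0 m n (*-cancelˡ-≡ ⟪ m , n ⟫ 0 2 (trans (sym (*-assoc 2 (2 ^ m) (2 * n + 1))) eq))

codeℕs-injective : ∀ ms ns → codeℕs ms ≡ codeℕs ns → ms ≡ ns
codeℕs-injective []       []       _  = refl
codeℕs-injective []       (n ∷ ns) eq = ⊥-elim (⟪⟫≢0 n (codeℕs ns) (sym eq))
codeℕs-injective (m ∷ ms) []       eq = ⊥-elim (⟪⟫≢0 m (codeℕs ms) eq)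
codeℕs-injective (m ∷ ms) (n ∷ ns) eq =
  let m≡n , eq′ = ⟪⟫-injective m (codeℕs ms) n (codeℕs ns) eq
  in cong₂ _∷_ m≡n (codeℕs-injective ms ns eq′)

-- Separating the scheme number from the coded parameters leaves only the diagonal cases in
-- `payload-injective`: distinct schemes have distinct tags.
tag payload : Index → ℕ

tag s1       = 1
tag (s2 _)   = 2
tag s3       = 3
tag (s4 _ _) = 4
tag (s5 _ _) = 5
tag (s6 _ _) = 6
tag (s8 _ _) = 8
tag (s9 _)   = 9

payload s1        = 0
payload (s2 q)    = q
payload s3        = 0
payload (s4 d e)  = ⟪ code d , code e ⟫
payload (s5 d e)  = ⟪ code d , code e ⟫
payload (s6 ns d) = ⟪ codeℕs ns , code d ⟫
payload (s8 i ds) = ⟪ i , codes ds ⟫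
payload (s9 k)    = k

code≡⟪tag,payload⟫ : ∀ e → code e ≡ ⟪ tag e , payload e ⟫
code≡⟪tag,payload⟫ s1       = refl
code≡⟪tag,payload⟫ (s2 _)   = refl
code≡⟪tag,payload⟫ s3       = refl
code≡⟪tag,payload⟫ (s4 _ _) = refl
code≡⟪tag,payload⟫ (s5 _ _) = refl
code≡⟪tag,payload⟫ (s6 _ _) = refl
code≡⟪tag,payload⟫ (s8 _ _) = refl
code≡⟪tag,payload⟫ (s9 _)   = refl

-- S9 knows the index to be run only through the number `m`; injectivity makes two S9 computations
-- with the same `m` run the same index.
code-injective    : ∀ d e → code d ≡ code e → d ≡ e
codes-injective   : ∀ ds es → codes ds ≡ codes es → ds ≡ es
payload-injective : ∀ d e → tag d ≡ tag e → payload d ≡ payload e → d ≡ e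

code-injective d e eq =
  uncurry (payload-injective d e) (⟪⟫-injective (tag d) (payload d) (tag e) (payload e)
    (trans (sym (code≡⟪tag,payload⟫ d)) (trans eq (code≡⟪tag,payload⟫ e))))

codes-injective []       []       _  = refl
codes-injective []       (e ∷ es) eq = ⊥-elim (⟪⟫≢0 (code e) (codes es) (sym eq))
codes-injective (d ∷ ds) []       eq = ⊥-elim (⟪⟫≢0 (code d) (codes ds) eq)
codes-injective (d ∷ ds) (e ∷ es) eq =
  let d≡e , ds≡es = ⟪⟫-injective (code d) (codes ds) (code e) (codes es) eq
  in cong₂ _∷_ (code-injective d e d≡e) (codes-injective ds es ds≡es)

payload-injective s1 s1 refl _ = refl
payload-injective (s2 _) (s2 _) refl eq = cong s2 eq
payload-injective s3 s3 refl _ = refl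
payload-injective (s4 d e) (s4 d′ e′) refl eq =
  let p , q = ⟪⟫-injective (code d) (code e) (code d′) (code e′) eq
  in cong₂ s4 (code-injective d d′ p) (code-injective e e′ q)
payload-injective (s5 d e) (s5 d′ e′) refl eq =
  let p , q = ⟪⟫-injective (code d) (code e) (code d′) (code e′) eq
  in cong₂ s5 (code-injective d d′ p) (code-injective e e′ q)
payload-injective (s6 ns d) (s6 ns′ d′) refl eq =
  let p , q = ⟪⟫-injective (codeℕs ns) (code d) (codeℕs ns′) (code d′) eq
  in cong₂ s6 (codeℕs-injective ns ns′ p) (code-injective d d′ q)
payload-injective (s8 i ds) (s8 i′ ds′) refl eq =
  let p , q = ⟪⟫-injective i (codes ds) i′ (codes ds′) eq
  in cong₂ s8 p (codes-injective ds ds′ q)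
payload-injective (s9 _) (s9 _) refl eq = cong s9 eq

-- Argument lists

-- Positions are natural numbers because elements of `Fin` are tied to the length of one list,
-- whereas slots and arguments are compared at the same position of different lists.
data At {A : Set} : List A → ℕ → A → Set where
  here  : ∀ {x xs} → At (x ∷ xs) 0 x
  there : ∀ {x y xs n} → At xs n y → At (x ∷ xs) (suc n) y

At-lookup : ∀ {A : Set} (xs : List A) i → At xs (toℕ i) (lookup xs i)
At-lookup (x ∷ xs) zero    = here
At-lookup (x ∷ xs) (suc i) = there (At-lookup xs i)

At⇒lookup : ∀ {A : Set} {xs : List A} {n x} → At xs n x → ∃[ i ] n ≡ toℕ i × lookup xs i ≡ x
At⇒lookup here      = zero , refl , refl
At⇒lookup (there p) with At⇒lookup p
... | i , refl , refl = suc i , refl , refl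

permute-At : ∀ φ⃗ π → Pointwise (At φ⃗) (tabulate (toℕ ∘ (π ⟨$⟩ʳ_))) (permute φ⃗ π)
permute-At φ⃗ π = tabulate⁺ (λ i → At-lookup φ⃗ (π ⟨$⟩ʳ i))

module _ {A B : Set} {R : A → B → Set} where

  at-left : ∀ {xs ys n y} → Pointwise R xs ys → At ys n y → ∃[ x ] At xs n x × R x y
  at-left (r ∷ _)  here      = _ , here , r
  at-left (_ ∷ rs) (there p) = let x , q , r = at-left rs p in x , there q , r

  at-right : ∀ {xs ys n x} → Pointwise R xs ys → At xs n x → ∃[ y ] At ys n y × R x y
  at-right (r ∷ _)  here      = _ , here , r
  at-right (_ ∷ rs) (there p) = let y , q , r = at-right rs p in y , there q , r

  at-both : ∀ {xs ys n x y} → Pointwise R xs ys → At xs n x → At ys n y → R x y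
  at-both (r ∷ _)  here      here      = r
  at-both (_ ∷ rs) (there p) (there q) = at-both rs p q

  -- The position list `ns` is part of the index in S6, so it fixes one rearrangement of the slots,
  -- whatever argument list and permutation a derivation uses.
  rearrange-left : ∀ {xs ys ns ys′} → Pointwise R xs ys → Pointwise (At ys) ns ys′ →
                   ∃[ xs′ ] Pointwise (At xs) ns xs′
  rearrange-left rs []       = [] , []
  rearrange-left rs (p ∷ ps) =
    let _ , q , _ = at-left rs p ; _ , qs = rearrange-left rs ps in _ , q ∷ qs

  rearrange : ∀ {xs ys ns xs′ ys′} → Pointwise R xs ys →
              Pointwise (At xs) ns xs′ → Pointwise (At ys) ns ys′ → Pointwise R xs′ ys′
  rearrange rs []       []       = []
  rearrange rs (p ∷ ps) (q ∷ qs) = at-both rs p q ∷ rearrange rs ps qs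

  take-Pointwise : ∀ k {xs ys} → Pointwise R xs ys → Pointwise R (take k xs) (take k ys)
  take-Pointwise zero    _        = []
  take-Pointwise (suc k) []       = []
  take-Pointwise (suc k) (r ∷ rs) = r ∷ take-Pointwise k rs

All-At : ∀ {A : Set} {Q : Pred A 0ℓ} {xs n x} → All Q xs → At xs n x → Q x
All-At (q ∷ _)  here      = q
All-At (_ ∷ qs) (there p) = All-At qs p

All-rearrange : ∀ {A : Set} {Q : Pred A 0ℓ} {xs ns xs′} →
                All Q xs → Pointwise (At xs) ns xs′ → All Q xs′
All-rearrange qs []       = []
All-rearrange qs (p ∷ ps) = All-At qs p ∷ All-rearrange qs ps

transport-permutation : ∀ {m n} → m ≡ n → (π : Permutation′ m) →
  Σ[ ρ ∈ Permutation′ n ] tabulate (toℕ ∘ (π ⟨$⟩ʳ_)) ≡ tabulate (toℕ ∘ (ρ ⟨$⟩ʳ_))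
transport-permutation refl π = π , refl

-- Types and their points

args-rank : ∀ τ {k} → rank τ ≤ k → ranks (args τ) ≤ k
args-rank 𝟘       _ = z≤n
args-rank (_ ⇒𝟘) r = r

head-rank : ∀ {σ σs k} → ranks (σ ∷ σs) ≤ suc k → rank σ ≤ k
head-rank {σ} {σs} r with m⊔n≤o⇒m≤o (suc (rank σ)) (ranks σs) r
... | s≤s r′ = r′

tail-rank : ∀ {σ σs k} → ranks (σ ∷ σs) ≤ k → ranks σs ≤ k
tail-rank {σ} {σs} r = m⊔n≤o⇒n≤o (suc (rank σ)) (ranks σs) r

rank≤0⇒𝟘 : ∀ {τ} → rank τ ≤ 0 → τ ≡ 𝟘
rank≤0⇒𝟘 {𝟘}              _ = refl
rank≤0⇒𝟘 {(σ ∷ σs) ⇒𝟘} r with m⊔n≤o⇒m≤o (suc (rank σ)) (ranks σs) r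
... | ()

unapp : ∀ τ (h : Fs (args τ) → ℕ) → Σ[ g ∈ F τ ] (∀ ξs → app τ g ξs ≡ h ξs)
unapp 𝟘      h = h tt , λ _ → refl
unapp (_ ⇒𝟘) h = h , λ _ → refl

appP-toPartial : ∀ τ (f : F τ) ξs → appP τ (toPartial τ f) ξs ≡ just (app τ f ξs)
appP-toPartial 𝟘      f ξs = refl
appP-toPartial (_ ⇒𝟘) f ξs = refl

-- The argument tuples at which functionals of any type are evaluated.
Point : Set
Point = ∃ Fs

-- One set of points serves components of all types. For a component of type `𝟘` the only relevant
-- point is `([] , tt)`, and agreement there is equality of numbers.
AgreeOn : Pred Point 0ℓ → ∀ {τs} → Fs τs → Fs τs → Set
AgreeOn p {[]}     _        _        = ⊤
AgreeOn p {τ ∷ τs} (f , fs) (g , gs) =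
  (∀ ξs → p (args τ , ξs) → app τ f ξs ≡ app τ g ξs) × AgreeOn p fs gs

AgreeOn-component : ∀ {p} τs {fs gs : Fs τs} → AgreeOn p fs gs → ∀ i ξs →
  p (args (lookup τs i) , ξs) →
  app (lookup τs i) (component τs fs i) ξs ≡ app (lookup τs i) (component τs gs i) ξs
AgreeOn-component (τ ∷ τs) (h , _)  zero    = h
AgreeOn-component (τ ∷ τs) (_ , hs) (suc i) = AgreeOn-component τs hs i

numericPoint : List ℕ → Point
numericPoint []       = [] , tt
numericPoint (n ∷ ns) = let σs , ξs = numericPoint ns in 𝟘 ∷ σs , n , ξs

numericPoint-surjective : ∀ {σs} → ranks σs ≤ 1 → (ξs : Fs σs) → ∃[ ns ] numericPoint ns ≡ (σs , ξs)
numericPoint-surjective {[]}     _ _        = [] , refl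
numericPoint-surjective {σ ∷ σs} r (n , ξs) with rank≤0⇒𝟘 {σ} (head-rank {σ} {σs} r)
... | refl with numericPoint-surjective (tail-rank {σ} {σs} r) ξs
...   | ns , eq = n ∷ ns , cong (λ (σs , ξs) → 𝟘 ∷ σs , n , ξs) eq

Halts : Index → List Arg → Set
Halts e φ⃗ = ∃[ a ] [ e ] φ⃗ ≃ a

-- Countable sets

Enum : Set → Set
Enum A = ℕ → Maybe A

⟦_⟧ : ∀ {A} → Enum A → Pred A 0ℓ
⟦ E ⟧ a = ∃[ n ] E n ≡ just a

∅ : ∀ {A} → Enum A
∅ _ = nothing

single : ∀ {A} → A → Enum A
single a _ = just a

module Classical (em : ExcludedMiddle 0ℓ) (ext : Extensionality 0ℓ 0ℓ) where

  -- Applied to an injective coding, this enumerates all of `A`.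
  decode : ∀ {A : Set} → (A → ℕ) → Enum A
  decode c n with em {∃[ a ] c a ≡ n}
  ... | yes (a , _) = just a
  ... | no _        = nothing

  decode-code : ∀ {A : Set} (c : A → ℕ) → (∀ a b → c a ≡ c b → a ≡ b) → ∀ a → decode c (c a) ≡ just a
  decode-code c inj a with em {∃[ b ] c b ≡ c a}
  ... | yes (b , eq) = cong just (inj b a eq)
  ... | no ¬b        = contradiction (a , refl) ¬b

  unpair : Enum (ℕ × ℕ)
  unpair = decode (uncurry ⟪_,_⟫)

  unpair-⟪⟫ : ∀ m n → unpair ⟪ m , n ⟫ ≡ just (m , n)
  unpair-⟪⟫ m n = decode-code (uncurry ⟪_,_⟫)
    (λ (m , n) (m′ , n′) eq → let p , q = ⟪⟫-injective m n m′ n′ eq in cong₂ _,_ p q) (m , n)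

  infixl 1 _>>=_
  -- A countable union of countable sets, dovetailed by the pairing.
  _>>=_ : ∀ {A B} → Enum A → (A → Enum B) → Enum B
  (E >>= f) n = unpair n Maybe.>>= λ (i , j) → E i Maybe.>>= λ a → f a j

  ∈->>= : ∀ {A B} (E : Enum A) (f : A → Enum B) {a b} → a ∈ ⟦ E ⟧ → b ∈ ⟦ f a ⟧ → b ∈ ⟦ E >>= f ⟧
  ∈->>= E f {a} {b} (i , p) (j , q) = ⟪ i , j ⟫ , eq
    where
    eq : (E >>= f) ⟪ i , j ⟫ ≡ just b
    eq rewrite unpair-⟪⟫ i j | p = q

  ⋃ : ∀ {A} → (ℕ → Enum A) → Enum A
  ⋃ Es = just >>= Es

  ∈-⋃ : ∀ {A} (Es : ℕ → Enum A) n → ⟦ Es n ⟧ ⊆ ⟦ ⋃ Es ⟧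
  ∈-⋃ Es n = ∈->>= just Es (n , refl)

  infixr 6 _∪_
  _∪_ : ∀ {A} → Enum A → Enum A → Enum A
  D ∪ E = ⋃ λ { zero → D ; (suc _) → E }

  ∈-∪ˡ : ∀ {A} (D E : Enum A) → ⟦ D ⟧ ⊆ ⟦ D ∪ E ⟧
  ∈-∪ˡ D E = ∈-⋃ _ 0

  ∈-∪ʳ : ∀ {A} (D E : Enum A) → ⟦ E ⟧ ⊆ ⟦ D ∪ E ⟧
  ∈-∪ʳ D E = ∈-⋃ _ 1

  fibre : ∀ {I : Set} {B : I → Set} → Enum (∃ B) → ∀ i → Enum (B i)
  fibre E i n with E n
  ... | nothing      = nothing
  ... | just (j , b) with em {j ≡ i}
  ...   | yes refl = just b
  ...   | no _     = nothing

  ∈-fibre : ∀ {I : Set} {B : I → Set} (E : Enum (∃ B)) {i b} → (i , b) ∈ ⟦ E ⟧ → b ∈ ⟦ fibre E i ⟧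
  ∈-fibre E {i} {b} (n , p) = n , eq
    where
    eq : fibre E i n ≡ just b
    eq rewrite p with em {i ≡ i}
    ... | yes refl = refl
    ... | no i≢i   = contradiction refl i≢i

  avoid : (E : Enum (F Baire)) → ∃[ x ] ¬ x ∈ ⟦ E ⟧
  avoid E = x , λ (n , p) → 1+n≢n (sym (cong (λ y → diagonal y n) p))
    where
    diagonal : Maybe (F Baire) → ℕ → ℕ
    diagonal nothing  _ = 0
    diagonal (just y) n = suc (y (n , tt))
    x : F Baire
    x (n , _) = diagonal (E n) n

  numericPoints : Enum Point
  numericPoints = decode codeℕs >>= (single ∘ numericPoint)

  ∈-numericPoints : ∀ {σs} → ranks σs ≤ 1 → (ξs : Fs σs) → (σs , ξs) ∈ ⟦ numericPoints ⟧
  ∈-numericPoints r ξs with numericPoint-surjective r ξs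
  ... | ns , refl = ∈->>= (decode codeℕs) (single ∘ numericPoint)
                      (codeℕs ns , decode-code codeℕs codeℕs-injective ns) (0 , refl)

  app-injective : ∀ τ {f g : F τ} → (∀ ξs → app τ f ξs ≡ app τ g ξs) → f ≡ g
  app-injective 𝟘      h = h tt
  app-injective (_ ⇒𝟘) h = ext h

  -- Each component has rank at most 1, so its argument tuples are tuples of numbers, and these are
  -- countable in number. Hence the arguments of a functional of rank at most 2 are determined by
  -- countably many values.
  AgreeOn-numericPoints : ∀ τs → ranks τs ≤ 2 → {fs gs : Fs τs} →
    AgreeOn ⟦ numericPoints ⟧ fs gs → fs ≡ gs
  AgreeOn-numericPoints []       _ _        = refl
  AgreeOn-numericPoints (τ ∷ τs) r (h , hs) = cong₂ _,_
    (app-injective τ λ ξs → h ξs (∈-numericPoints (args-rank τ (head-rank {τ} {τs} r)) ξs))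
    (AgreeOn-numericPoints τs (tail-rank {τ} {τs} r) hs)

  -- Countably based functionals and `Ω₁`

  -- A form of `CountablyBased` with one enumeration of points for all components together. It lies
  -- in `Set`, so slots can carry it.
  Based : ∀ τ → F τ → Set
  Based τ Φ = ∀ fs → Σ[ q ∈ Enum Point ] (∀ gs → AgreeOn ⟦ q ⟧ fs gs → app τ Φ fs ≡ app τ Φ gs)

  CountablyBased⇒Based : ∀ {τ} {Φ : F τ} → CountablyBased {τ} Φ → Based τ Φ
  CountablyBased⇒Based {τ} (_ , base) fs with base fs
  ... | X , countable , determined = (fins >>= points) , λ gs agree →
        determined gs λ i ξs ξs∈X → AgreeOn-component (args τ) agree i ξs
          (∈->>= fins points (toℕ i , decode-code toℕ (λ _ _ → toℕ-injective) i)
            (let n , eq = Equivalence.to (proj₂ (countable i) ξs) ξs∈X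
             in n , cong (Maybe.map _) eq))
    where
    fins : Enum (Fin (length (args τ)))
    fins = decode toℕ
    points : Fin (length (args τ)) → Enum Point
    points i n = Maybe.map (args (lookup (args τ) i) ,_) (proj₁ (countable i) n)

  Ω₁-defined : ∀ X n {a} → Ω₁ em (X , n , tt) ≡ just a → ∃[ x ] IsSingleton X x × a ≡ x (n , tt)
  Ω₁-defined X n eq with em {∃[ x ] IsSingleton X x}
  Ω₁-defined X n refl | yes (x , s) = x , s , refl

  IsSingleton-∋ : ∀ {X x} y → IsSingleton X x → X (y , tt) ≡ 1 → y ≡ x
  IsSingleton-∋ {X} {x} y s eq with em {y ≡ x}
  ... | yes p = p
  ... | no ¬p with trans (sym eq) (proj₂ (s y) ¬p)
  ...   | ()

  Ω₁-singleton : ∀ X n {x} → IsSingleton X x → Ω₁ em (X , n , tt) ≡ just (x (n , tt))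
  Ω₁-singleton X n {x} s with em {∃[ x ] IsSingleton X x}
  ... | yes (y , s′) = cong (λ z → just (z (n , tt))) (IsSingleton-∋ y s (proj₁ (s′ y) refl))
  ... | no ¬s        = contradiction (x , s) ¬s

  -- A slot describes an argument of a computation: the argument may vary
  -- only in a low slot, the other slots fix it.
  data Slot : Set where
    number : ℕ → Slot
    low    : ∀ τs → rank (τs ⇒𝟘) ≤ 2 → F (τs ⇒𝟘) → Slot
    based  : ∀ τs → rank (τs ⇒𝟘) ≤ 3 → (Φ : F (τs ⇒𝟘)) → Based (τs ⇒𝟘) Φ → Slot
    omega  : Slot

  -- With `U` for `p`, a low argument has the prescribed values everywhere; with the empty set, it
  -- is any total functional of the given type.
  data Matches (p : Pred Point 0ℓ) : Slot → Arg → Set where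
    number : ∀ {n} → Matches p (number n) (num n)
    low    : ∀ {τs r f} g → (∀ ξs → p (toList τs , ξs) → f ξs ≡ g ξs) →
             Matches p (low τs r f) (τs ⇒𝟘 , just ∘ g)
    based  : ∀ {τs r Φ b} → Matches p (based τs r Φ b) (τs ⇒𝟘 , just ∘ Φ)
    omega  : Matches p omega (Ω₁Ty , Ω₁ em)

  infix 4 _⊢_≈_
  _⊢_≈_ : Pred Point 0ℓ → List Slot → List Arg → Set
  p ⊢ Γ ≈ φ⃗ = Pointwise (Matches p) Γ φ⃗

  weaken : ∀ {p q Γ φ⃗} → p ⊆ q → q ⊢ Γ ≈ φ⃗ → p ⊢ Γ ≈ φ⃗
  weaken {p} {q} p⊆q = Pointwise-map weaken₁
    where
    weaken₁ : ∀ {s A} → Matches q s A → Matches p s A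
    weaken₁ number    = number
    weaken₁ (low g h) = low g λ ξs → h ξs ∘ p⊆q
    weaken₁ based     = based
    weaken₁ omega     = omega

  slot : ∀ τ → rank τ ≤ 2 → F τ → Slot
  slot 𝟘       _ n = number n
  slot (τs ⇒𝟘) r f = low τs r f

  slots : ∀ {τs} → ranks τs ≤ 3 → Fs τs → List Slot
  slots {[]}     _ _        = []
  slots {τ ∷ τs} r (f , fs) = slot τ (head-rank {τ} {τs} r) f ∷ slots {τs} (tail-rank {τ} {τs} r) fs

  slots-refl : ∀ {p τs} (r : ranks τs ≤ 3) (fs : Fs τs) → p ⊢ slots {τs} r fs ≈ totals fs
  slots-refl {τs = []}     r _        = []
  slots-refl {p} {τ ∷ τs} r (f , fs) =
    match τ (head-rank {τ} {τs} r) f ∷ slots-refl {τs = τs} (tail-rank {τ} {τs} r) fs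
    where
    match : ∀ τ r f → Matches p (slot τ r f) (total {τ} f)
    match 𝟘      r n = number
    match (_ ⇒𝟘) r f = low f λ _ _ → refl

  -- Number slots admit no variation; the point `([] , tt)` in `p` turns agreement of number
  -- components into equality.
  slots-≈ : ∀ {p τs} (r : ranks τs ≤ 3) (fs gs : Fs τs) → p ([] , tt) → AgreeOn p fs gs →
            p ⊢ slots {τs} r fs ≈ totals gs
  slots-≈ {τs = []}    r _        _        _  _        = []
  slots-≈ {p} {τ ∷ τs} r (f , fs) (g , gs) p₀ (h , hs) =
    match τ (head-rank {τ} {τs} r) f g h ∷ slots-≈ {τs = τs} (tail-rank {τ} {τs} r) fs gs p₀ hs
    where
    match : ∀ τ r (f g : F τ) → (∀ ξs → p (args τ , ξs) → app τ f ξs ≡ app τ g ξs) →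
            Matches p (slot τ r f) (total {τ} g)
    match 𝟘      r n m h with h tt p₀
    ... | refl = number
    match (_ ⇒𝟘) r f g h = low g h

  Matches-rank : ∀ {p s τs f} → Matches p s (τs ⇒𝟘 , f) → rank (τs ⇒𝟘) ≤ 3
  Matches-rank (low {r = r} _ _)  = m≤n⇒m≤1+n r
  Matches-rank (based {r = r})    = r
  Matches-rank omega              = s≤s (s≤s (s≤s z≤n))

  Matches-args : ∀ {p q s τs τs′ f f′} → Matches p s (τs ⇒𝟘 , f) → Matches q s (τs′ ⇒𝟘 , f′) → τs ≡ τs′
  Matches-args (low _ _) (low _ _) = refl
  Matches-args based     based     = refl
  Matches-args omega     omega     = refl

  -- The case of a single oracle call. A low oracle has arguments determined by their numeric
  -- points, and its replacement agrees with it at `gs`; a based oracle brings its own set; for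
  -- `Ω₁`, the number argument and the element of the singleton suffice.
  slot-modulus : ∀ {s τs f a} → Matches U s (τs ⇒𝟘 , f) → (gs : Fs (toList τs)) → f gs ≡ just a →
    Σ[ q ∈ Enum Point ] (∀ {p f′ hs b} → p (toList τs , gs) → Matches p s (τs ⇒𝟘 , f′) →
      AgreeOn ⟦ q ⟧ gs hs → f′ hs ≡ just b → a ≡ b)
  slot-modulus {τs = τs} (low {r = r} g h) gs refl = numericPoints , same
    where
    same : ∀ {p f′ hs b} → p (toList τs , gs) → Matches p (low τs r _) (τs ⇒𝟘 , f′) →
           AgreeOn ⟦ numericPoints ⟧ gs hs → f′ hs ≡ just b → g gs ≡ b
    same pgs (low g′ h′) agree eq with AgreeOn-numericPoints (toList τs) r agree
    ... | refl = trans (sym (h gs tt)) (trans (h′ gs pgs) (just-injective eq))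
  slot-modulus {τs = τs} (based {r = r} {Φ} {b}) gs refl =
    proj₁ (b gs) , λ { _ based agree eq → trans (proj₂ (b gs) _ agree) (just-injective eq) }
  slot-modulus {a = a} omega (X , n , tt) eq with Ω₁-defined X n eq
  ... | x , s , refl = points , same
    where
    -- Agreement at `([] , tt)` equates the number arguments; agreement at `x` puts `x` into the
    -- second singleton.
    at-number at-x points : Enum Point
    at-number = single ([] , tt)
    at-x      = single (Baire ∷ [] , x , tt)
    points    = at-number ∪ at-x
    same : ∀ {p f′ hs b} → p _ → Matches p omega (Ω₁Ty , f′) →
           AgreeOn ⟦ points ⟧ (X , n , tt) hs → f′ hs ≡ just b → x (n , tt) ≡ b
    same {hs = Y , m , tt} _ omega (X≡Y , n≡m , _) eq′ with Ω₁-defined Y m eq′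
    ... | y , s′ , refl
      with n≡m tt (∈-∪ˡ at-number at-x (0 , refl))
         | IsSingleton-∋ x s′ (trans (sym (X≡Y (x , tt) (∈-∪ʳ at-number at-x (0 , refl))))
                                     (proj₁ (s x) refl))
    ... | refl | refl = refl

  -- Convergent computations

  -- Convergence at `ψ⃗` is a premise: stability excludes a different value, not divergence.
  Stable : Enum Point → List Slot → Index → ℕ → Set
  Stable q Γ e a = ∀ {ψ⃗ b} → ⟦ q ⟧ ⊢ Γ ≈ ψ⃗ → [ e ] ψ⃗ ≃ b → a ≡ b

  -- By induction on the derivation, uniting the sets of the subcomputations. S8 may have
  -- uncountably many of these, but the value of the oracle depends on their results at the
  -- countably many points of `Y` only.
  modulus : ∀ {e Γ φ⃗ a} → U ⊢ Γ ≈ φ⃗ → [ e ] φ⃗ ≃ a → Σ[ q ∈ Enum Point ] Stable q Γ e a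
  moduli  : ∀ {ds Γ φ⃗ τs} {gs : Fs τs} → ranks τs ≤ 3 → (Y : Enum Point) →
    U ⊢ Γ ≈ φ⃗ → [ ds ] φ⃗ ≃s gs →
    Σ[ q ∈ Enum Point ] (∀ {ψ⃗} {hs : Fs τs} → ⟦ q ⟧ ⊢ Γ ≈ ψ⃗ → [ ds ] ψ⃗ ≃s hs → AgreeOn ⟦ Y ⟧ gs hs)

  modulus (number ∷ _) S1 = ∅ , λ { (number ∷ _) S1 → refl }
  modulus _            S2 = ∅ , λ { _ S2 → refl }
  modulus (number ∷ _) S3 = ∅ , λ { (number ∷ _) S3 → refl }
  modulus {s4 d e} {Γ} m (S4 {a = a} D₁ D₂) with modulus m D₁ | modulus (number ∷ m) D₂
  ... | q₁ , h₁ | q₂ , h₂ = q₁ ∪ q₂ , same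
    where
    same : Stable (q₁ ∪ q₂) Γ (s4 d e) a
    same m (S4 E₁ E₂) with h₁ (weaken (∈-∪ˡ q₁ q₂) m) E₁
    ... | refl = h₂ (number ∷ weaken (∈-∪ʳ q₁ q₂) m) E₂
  modulus (number ∷ m) (S5-zero D) with modulus m D
  ... | q , h = q , λ { (number ∷ m) (S5-zero E) → h m E }
  modulus {s5 d e} {Γ} (number ∷ m) (S5-suc {a = a} D₁ D₂)
    with modulus (number ∷ m) D₁ | modulus (number ∷ number ∷ m) D₂
  ... | q₁ , h₁ | q₂ , h₂ = q₁ ∪ q₂ , same
    where
    same : Stable (q₁ ∪ q₂) Γ (s5 d e) a
    same (number ∷ m) (S5-suc E₁ E₂) with h₁ (number ∷ weaken (∈-∪ˡ q₁ q₂) m) E₁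
    ... | refl = h₂ (number ∷ number ∷ weaken (∈-∪ʳ q₁ q₂) m) E₂
  modulus {φ⃗ = φ⃗} m (S6 π refl D) with rearrange-left m (permute-At φ⃗ π)
  ... | Γ′ , at with modulus (rearrange m at (permute-At φ⃗ π)) D
  ...   | q , h = q , λ { {ψ⃗} m (S6 ρ eq E) →
            h (rearrange m at (subst (λ ns → Pointwise (At ψ⃗) ns _) (sym eq) (permute-At ψ⃗ ρ))) E }
  modulus {s8 i ds} {Γ} {φ⃗} m (S8 {τs = τs} {a} j refl eq gs D fgs)
    with at-left m (subst (At φ⃗ (toℕ j)) eq (At-lookup φ⃗ j))
  ... | s , at , match with slot-modulus match gs fgs
  ...   | Y , h₁ with moduli (Matches-rank match) Y m D
  ...     | q , h₂ = single (toList τs , gs) ∪ q , same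
    where
    -- The point `gs` is added because a low oracle may be replaced by one that agrees with it only
    -- on this set.
    q′ : Enum Point
    q′ = single (toList τs , gs) ∪ q
    same : Stable q′ Γ (s8 i ds) a
    same {ψ⃗} m′ (S8 k refl′ eq′ hs E fhs)
      with at-both m′ at (subst (At ψ⃗ _) eq′ (subst (λ n → At ψ⃗ n _) (sym refl′) (At-lookup ψ⃗ k)))
    ... | match′ with Matches-args match match′
    ...   | refl = h₁ (∈-∪ˡ (single (toList τs , gs)) q (0 , refl)) match′
                      (h₂ (weaken (∈-∪ʳ (single (toList τs , gs)) q) m′) E) fhs
  modulus {s9 k} {Γ} (number ∷ m) (S9 {d = d} {a = a} eq _ D) with modulus (take-Pointwise k m) D
  ... | q , h = q , same
    where
    same : Stable q Γ (s9 k) a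
    same (number ∷ m′) (S9 {d = d′} eq′ _ E) with code-injective d d′ (trans (sym eq) eq′)
    ... | refl = h (take-Pointwise k m′) E

  moduli r Y m [] = ∅ , λ { _ [] → tt }
  moduli {Γ = Γ} r Y m (_∷_ {d = d} {ds} {τ = τ} {τs} {g} {gs} D Ds)
    with moduli (tail-rank {τ} {τs} r) Y m Ds
  ... | q′ , h′ = heads ∪ q′ , same
    where
    r′ : ranks (args τ) ≤ 3
    r′ = args-rank τ (m≤n⇒m≤1+n (head-rank {τ} {τs} r))
    at-point : ∀ ξs → Σ[ q ∈ Enum Point ] Stable q (slots r′ ξs ++ Γ) d (app τ g ξs)
    at-point ξs = modulus (++⁺ (slots-refl r′ ξs) m) (D ξs)
    -- Only the points of `Y` contribute, which keeps the union countable.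
    heads : Enum Point
    heads = fibre Y (args τ) >>= (proj₁ ∘ at-point)
    same : ∀ {ψ⃗} {hs : Fs (τ ∷ τs)} → ⟦ heads ∪ q′ ⟧ ⊢ Γ ≈ ψ⃗ → [ d ∷ ds ] ψ⃗ ≃s hs →
           AgreeOn ⟦ Y ⟧ (g , gs) hs
    same m′ (E ∷ Es) =
      (λ ξs ξs∈Y → proj₂ (at-point ξs)
         (++⁺ (slots-refl r′ ξs)
              (weaken (∈-∪ˡ heads q′ ∘ ∈->>= (fibre Y (args τ)) (proj₁ ∘ at-point) (∈-fibre Y ξs∈Y)) m′))
         (E ξs)) ,
      h′ (weaken (∈-∪ʳ heads q′) m′) Es

  -- Divergent computations

  data Pick : List Index → List Ty → Index → Ty → Set where
    here  : ∀ {d ds τ τs} → Pick (d ∷ ds) (τ ∷ τs) d τ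
    there : ∀ {d d′ ds τ τ′ τs} → Pick ds τs d τ → Pick (d′ ∷ ds) (τ′ ∷ τs) d τ

  Pick-rank : ∀ {ds τs d τ} → Pick ds τs d τ → ranks τs ≤ 3 → ranks (args τ) ≤ 3
  Pick-rank {τs = τ ∷ τs} here      r = args-rank τ (m≤n⇒m≤1+n (head-rank {τ} {τs} r))
  Pick-rank {τs = τ ∷ τs} (there p) r = Pick-rank p (tail-rank {τ} {τs} r)

  Config : Set
  Config = Index × List Slot

  -- Steps relate slots rather than arguments, so that one path applies to all arguments matching
  -- the slots. Entering the second computation of S4 or S5 requires the value of the first to be
  -- stable on `q`. `dead` covers configurations at which no matching arguments give a value; its
  -- target is arbitrary.
  data Step (q : Enum Point) : Config → Config → Set where
    s4ˡ  : ∀ {d e Γ} → Step q (s4 d e , Γ) (e , Γ)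
    s4ʳ  : ∀ {d e Γ b} → Stable q Γ e b → Step q (s4 d e , Γ) (d , number b ∷ Γ)
    s5⁰  : ∀ {d e Γ} → Step q (s5 d e , number 0 ∷ Γ) (d , Γ)
    s5ˡ  : ∀ {d e x Γ} → Step q (s5 d e , number (suc x) ∷ Γ) (s5 d e , number x ∷ Γ)
    s5ʳ  : ∀ {d e x Γ b} → Stable q (number x ∷ Γ) (s5 d e) b →
           Step q (s5 d e , number (suc x) ∷ Γ) (e , number b ∷ number x ∷ Γ)
    s6   : ∀ {ns d Γ Γ′} → Pointwise (At Γ) ns Γ′ → Step q (s6 ns d , Γ) (d , Γ′)
    s8   : ∀ {i ds Γ s τs f d τ} → At Γ i s → Matches U s (τs ⇒𝟘 , f) → Pick ds (toList τs) d τ →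
           (r : ranks (args τ) ≤ 3) (ξs : Fs (args τ)) →
           Step q (s8 i ds , Γ) (d , slots r ξs ++ Γ)
    s9   : ∀ {k d Γ} → Step q (s9 k , number (code d) ∷ Γ) (d , take k Γ)
    dead : ∀ {e Γ c} → (∀ {ψ⃗ a} → ⟦ q ⟧ ⊢ Γ ≈ ψ⃗ → ¬ [ e ] ψ⃗ ≃ a) → Step q (e , Γ) c

  -- A derivation would have to follow the infinite path.
  module _ (path : ℕ → Config) (qs : ℕ → Enum Point)
           (steps : ∀ n → Step (qs n) (path n) (path (suc n))) where

    follow  : ∀ {e Γ ψ⃗ a} n → path n ≡ (e , Γ) → ⟦ ⋃ qs ⟧ ⊢ Γ ≈ ψ⃗ → ¬ [ e ] ψ⃗ ≃ a
    follows : ∀ {ds τs d τ Γ ψ⃗} {hs : Fs τs} n (r : ranks (args τ) ≤ 3) (ξs : Fs (args τ)) →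
              path n ≡ (d , slots r ξs ++ Γ) → Pick ds τs d τ → ⟦ ⋃ qs ⟧ ⊢ Γ ≈ ψ⃗ → ¬ [ ds ] ψ⃗ ≃s hs

    follow n at-n m D with path n | path (suc n) in next | steps n
    follow n refl m D | _ | _ | dead ¬D = ¬D (weaken (∈-⋃ qs n) m) D
    follow n refl m (S4 D₁ D₂) | _ | _ | s4ˡ = follow (suc n) next m D₁
    -- Stability identifies the value found by `D₁` with the number on the path.
    follow n refl m (S4 D₁ D₂) | _ | _ | s4ʳ h with h (weaken (∈-⋃ qs n) m) D₁
    ... | refl = follow (suc n) next (number ∷ m) D₂
    follow n refl (number ∷ m) (S5-zero D) | _ | _ | s5⁰ = follow (suc n) next m D
    follow n refl (number ∷ m) (S5-suc D₁ D₂) | _ | _ | s5ˡ = follow (suc n) next (number ∷ m) D₁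
    follow n refl (number ∷ m) (S5-suc D₁ D₂) | _ | _ | s5ʳ h
      with h (number ∷ weaken (∈-⋃ qs n) m) D₁
    ... | refl = follow (suc n) next (number ∷ number ∷ m) D₂
    follow {ψ⃗ = ψ⃗} n refl m (S6 π refl D) | _ | _ | s6 at =
      follow (suc n) next (rearrange m at (permute-At ψ⃗ π)) D
    follow {ψ⃗ = ψ⃗} n refl m (S8 j refl eq hs D _) | _ | _ | s8 at match pick r ξs
      with at-both m at (subst (At ψ⃗ (toℕ j)) eq (At-lookup ψ⃗ j))
    ... | match′ with Matches-args match match′
    ...   | refl = follows (suc n) r ξs next pick m D
    follow n refl (number ∷ m) (S9 {d = d′} eq _ D) | _ | _ | s9 {k} {d} with code-injective d d′ eq
    ... | refl = follow (suc n) next (take-Pointwise k m) D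

    follows n r ξs at-n here         m (D ∷ _)  = follow n at-n (++⁺ (slots-refl r ξs) m) (D ξs)
    follows n r ξs at-n (there pick) m (_ ∷ Ds) = follows n r ξs at-n pick m Ds

  -- `Ω₁` may be undefined although all subcomputations of the call converge. Without `omega` slots,
  -- a divergent oracle call always has a divergent subcomputation.
  record Divergence : Set where
    constructor diverge
    field
      {idx}     : Index
      {slots₀}  : List Slot
      {args₀}   : List Arg
      matches   : U ⊢ slots₀ ≈ args₀
      no-omega  : All (_≢ omega) slots₀
      diverges  : ¬ Halts idx args₀

    config : Config
    config = idx , slots₀

  open Divergence using (config)

  slots-≢omega : ∀ {τs} (r : ranks τs ≤ 3) (fs : Fs τs) → All (_≢ omega) (slots {τs} r fs)
  slots-≢omega {[]}     r _        = []
  slots-≢omega {τ ∷ τs} r (f , fs) = ≢omega τ _ f ∷ slots-≢omega {τs} _ fs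
    where
    ≢omega : ∀ τ r f → slot τ r f ≢ omega
    ≢omega 𝟘      _ _ ()
    ≢omega (_ ⇒𝟘) _ _ ()

  Matches-total : ∀ {p q s A τs f} → s ≢ omega → Matches p s A → Matches q s (τs ⇒𝟘 , f) →
                  Σ[ g ∈ F (τs ⇒𝟘) ] A ≡ (τs ⇒𝟘 , just ∘ g)
  Matches-total _ (low g _) (low _ _) = g , refl
  Matches-total _ based     based     = _ , refl
  Matches-total ω _         omega     = contradiction refl ω

  -- The derivation at `ψ⃗` pairs the indices `ds` with the types `τs`. If no component diverges
  -- anywhere at `φ⃗`, its values form total functionals.
  diverging-component : ∀ {ds ψ⃗ τs} {hs : Fs τs} φ⃗ → [ ds ] ψ⃗ ≃s hs →
    (∃[ d ] ∃[ τ ] Pick ds τs d τ × (Σ[ ξs ∈ Fs (args τ) ] ¬ Halts d (totals ξs ++ φ⃗))) ⊎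
    (Σ[ gs ∈ Fs τs ] [ ds ] φ⃗ ≃s gs)
  diverging-component φ⃗ [] = inj₂ (tt , [])
  diverging-component φ⃗ (_∷_ {d = d} {τ = τ} _ Ds) with diverging-component φ⃗ Ds
  ... | inj₁ (d′ , τ′ , pick , rest) = inj₁ (d′ , τ′ , there pick , rest)
  ... | inj₂ (gs , Es) with em {Σ[ ξs ∈ Fs (args τ) ] ¬ Halts d (totals ξs ++ φ⃗)}
  ...   | yes (ξs , div) = inj₁ (d , τ , here , ξs , div)
  ...   | no ¬div = inj₂ ((g , gs) , (λ ξs → subst ([ d ] _ ≃_) (sym (g≡ ξs)) (proj₂ (halts ξs))) ∷ Es)
    where
    halts : ∀ ξs → Halts d (totals ξs ++ φ⃗)
    halts ξs with em {Halts d (totals ξs ++ φ⃗)}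
    ... | yes h = h
    ... | no ¬h = contradiction (ξs , ¬h) ¬div
    g : F τ
    g = proj₁ (unapp τ (proj₁ ∘ halts))
    g≡ : ∀ ξs → app τ g ξs ≡ proj₁ (halts ξs)
    g≡ = proj₂ (unapp τ (proj₁ ∘ halts))

  -- Some immediate subcomputation diverges. If it is the second one of S4 or S5, `modulus` makes
  -- the value of the first stable.
  step : (s : Divergence) → Σ[ q ∈ Enum Point ] Σ[ t ∈ Divergence ] Step q (config s) (config t)
  step s@(diverge {e} {Γ} m ω div)
    -- Any convergent computation from the same index and slots, with low arguments arbitrary, shows
    -- that the scheme fits the argument list. If there is none, the step is `dead` and the path
    -- stays at `s`.
    with em {∃[ ψ⃗ ] ∃[ a ] (⟦ ∅ ⟧ ⊢ Γ ≈ ψ⃗ × [ e ] ψ⃗ ≃ a)}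
  ... | no ¬conv = ∅ , s , dead λ m D → ¬conv (_ , _ , m , D)
  ... | yes (ψ⃗ , _ , m′ , D) = from-shape D m′ m ω div
    where
    from-shape : ∀ {e Γ φ⃗ ψ⃗ a} → [ e ] ψ⃗ ≃ a → ⟦ ∅ ⟧ ⊢ Γ ≈ ψ⃗ →
      U ⊢ Γ ≈ φ⃗ → All (_≢ omega) Γ → ¬ Halts e φ⃗ →
      Σ[ q ∈ Enum Point ] Σ[ t ∈ Divergence ] Step q (e , Γ) (config t)
    from-shape S1 (number ∷ _) (number ∷ _) _ div = contradiction (_ , S1) div
    from-shape S2 _ _ _ div = contradiction (_ , S2) div
    from-shape S3 (number ∷ _) (number ∷ _) _ div = contradiction (_ , S3) div
    from-shape {φ⃗ = φ⃗} (S4 {e = e} _ _) _ m ω div with em {Halts e φ⃗}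
    ... | no ¬h = ∅ , diverge m ω ¬h , s4ˡ
    ... | yes (b , E) with modulus m E
    ...   | q , h = q , diverge (number ∷ m) ((λ ()) ∷ ω) (λ (a , E′) → div (a , S4 E E′)) , s4ʳ h
    from-shape (S5-zero _) (number ∷ _) (number ∷ m) (_ ∷ ω) div =
      ∅ , diverge m ω (λ (a , E) → div (a , S5-zero E)) , s5⁰
    from-shape {φ⃗ = _ ∷ φ⃗} (S5-suc {d} {e} {x} _ _) (number ∷ _) (number ∷ m) (_ ∷ ω) div
      with em {Halts (s5 d e) (num x ∷ φ⃗)}
    ... | no ¬h = ∅ , diverge (number ∷ m) ((λ ()) ∷ ω) ¬h , s5ˡ
    ... | yes (b , E) with modulus (number ∷ m) E
    ...   | q , h = q , diverge (number ∷ number ∷ m) ((λ ()) ∷ (λ ()) ∷ ω)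
                          (λ (a , E′) → div (a , S5-suc E E′)) , s5ʳ h
    from-shape {φ⃗ = φ⃗} {ψ⃗} (S6 π refl _) m′ m ω div
      -- The permutation acts on the positions of `ψ⃗`; `φ⃗` has the same length.
      with transport-permutation (trans (sym (Pointwise-length m′)) (Pointwise-length m)) π
         | rearrange-left m′ (permute-At ψ⃗ π)
    ... | ρ , eq | Γ′ , at = ∅ ,
      diverge (rearrange m at (subst (λ ns → Pointwise (At φ⃗) ns _) (sym eq) (permute-At φ⃗ ρ)))
              (All-rearrange ω at) (λ (a , E) → div (a , S6 ρ eq E)) ,
      s6 at
    from-shape {φ⃗ = φ⃗} {ψ⃗} (S8 j refl eq hs D _) m′ m ω div
      with at-left m′ (subst (At ψ⃗ (toℕ j)) eq (At-lookup ψ⃗ j))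
    ... | s , at , match′ with at-right m at
    ...   | A , at′ , match with Matches-total (All-At ω at) match match′ | diverging-component φ⃗ D
    ...     | g , refl | inj₁ (d , τ , pick , ξs , ¬h) = ∅ ,
      diverge (++⁺ (slots-refl r ξs) m) (All-++⁺ (slots-≢omega r ξs) ω) ¬h ,
      s8 at match pick r ξs
      where r = Pick-rank pick (Matches-rank match)
    -- All components are total and so is the oracle, so S8 would give a value at `φ⃗`.
    ...     | g , refl | inj₂ (gs , E) with At⇒lookup at′
    ...       | k , j≡k , eq′ = contradiction (_ , S8 k j≡k eq′ gs E refl) div
    from-shape (S9 {k} {d = d} refl k≤ _) (number ∷ m′) (number ∷ m) (_ ∷ ω) div =
      ∅ , diverge {d} (take-Pointwise k m) (All-take⁺ k ω) (λ (a , E) → div (a , S9 refl k≤′ E)) , s9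
      where k≤′ = subst (k ≤_) (trans (sym (Pointwise-length m′)) (Pointwise-length m)) k≤

  divergence-modulus : (s : Divergence) → let open Divergence s in
    Σ[ q ∈ Enum Point ] (∀ {ψ⃗ a} → ⟦ q ⟧ ⊢ slots₀ ≈ ψ⃗ → ¬ [ idx ] ψ⃗ ≃ a)
  divergence-modulus s = ⋃ qs , follow (config ∘ path) qs (λ n → proj₂ (proj₂ (step (path n)))) 0 refl
    where
    path : ℕ → Divergence
    path zero    = s
    path (suc n) = proj₁ (proj₂ (step (path n)))
    qs : ℕ → Enum Point
    qs n = proj₁ (step (path n))

  outcome-modulus : ∀ e {Γ φ⃗} → U ⊢ Γ ≈ φ⃗ → All (_≢ omega) Γ →
    Σ[ q ∈ Enum Point ] ∃[ a ] Stable q Γ e a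
  outcome-modulus e {φ⃗ = φ⃗} m ω with em {Halts e φ⃗}
  ... | yes (a , D) = let q , h = modulus m D in q , a , h
  -- The value 0 is a dummy: no computation matching on `q` converges, so stability holds vacuously.
  ... | no ¬h = let q , h = divergence-modulus (diverge m ω ¬h)
                in q , 0 , λ m′ D → contradiction D (h m′)

  -- Consequences for `Ξ` and `Ω₁`

  -- Since `Φ` is total, the computations at `fs` and at `gs` both converge, and stability equates
  -- their values. Thus `Ω₁` may be among the oracles.
  computable⇒Based : ∀ {Γ φ⃗ τ} (Φ : F τ) → rank τ ≤ 3 → (∀ {p} → p ⊢ Γ ≈ φ⃗) →
    ComputableIn φ⃗ (total {τ} Φ) → Based τ Φ
  computable⇒Based {Γ} {τ = τ} Φ r m (e , computes) fs
    with modulus (++⁺ (slots-refl (args-rank τ r) fs) m) (computes fs _ (appP-toPartial τ Φ fs))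
  ... | q , h = single ([] , tt) ∪ q , λ gs agree →
    h (++⁺ (weaken (∈-∪ʳ (single ([] , tt)) q)
             (slots-≈ (args-rank τ r) fs gs (∈-∪ˡ (single ([] , tt)) q (0 , refl)) agree)) m)
      (computes gs _ (appP-toPartial τ Φ gs))

  totalSlot : ∀ {τ} → rank τ ≤ 3 → (Φ : F τ) → Based τ Φ → Slot
  totalSlot {𝟘}       _ n _ = number n
  totalSlot {τs ⇒𝟘} r Φ b = based τs r Φ b

  totalSlot-matches : ∀ {p} τ r Φ b → Matches p (totalSlot {τ} r Φ b) (total {τ} Φ)
  totalSlot-matches 𝟘      _ _ _ = number
  totalSlot-matches (_ ⇒𝟘) _ _ _ = based

  totalSlot-≢omega : ∀ τ r Φ b → totalSlot {τ} r Φ b ≢ omega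
  totalSlot-≢omega 𝟘      _ _ _ ()
  totalSlot-≢omega (_ ⇒𝟘) _ _ _ ()

  Ω₁-not-computable : ∀ {Γ φ⃗} → (∀ {p} → p ⊢ Γ ≈ φ⃗) → All (_≢ omega) Γ →
    ¬ ComputableIn φ⃗ (Ω₁Ty , Ω₁ em)
  Ω₁-not-computable {Γ} {φ⃗} m ω (e , computes) =
    x∉ (∈-∪ˡ (single b) seen (0 , cong just (sym (ext x≡b))))
    where
    -- The constant function 0 is the characteristic function of the empty set.
    inputs : ℕ → List Slot
    inputs n = low (Baire ∷ []) (s≤s (s≤s z≤n)) (λ _ → 0) ∷ number n ∷ Γ
    outcome : ∀ n → Σ[ q ∈ Enum Point ] ∃[ a ] Stable q (inputs n) e a
    outcome n = outcome-modulus e (low (λ _ → 0) (λ _ _ → refl) ∷ number ∷ m) ((λ ()) ∷ (λ ()) ∷ ω)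
    -- The only values that the algorithm can return on sets that look empty at the points of
    -- `outcome`.
    b : F Baire
    b (n , _) = proj₁ (proj₂ (outcome n))
    points : Enum Point
    points = ⋃ (proj₁ ∘ outcome)
    seen : Enum (F Baire)
    seen = fibre points (Baire ∷ []) >>= (single ∘ proj₁)
    -- Avoiding `seen` makes the singleton of `x` look empty for every `n` at once; avoiding `b`
    -- makes the resulting output wrong.
    x : F Baire
    x = proj₁ (avoid (single b ∪ seen))
    x∉ : ¬ x ∈ ⟦ single b ∪ seen ⟧
    x∉ = proj₂ (avoid (single b ∪ seen))
    indicator : ∀ {y} → Dec (y ≡ x) → ℕ
    indicator (yes _) = 1
    indicator (no _)  = 0
    X : F ((Baire ∷ []) ⇒𝟘)
    X (y , _) = indicator (em {y ≡ x})
    X-singleton : IsSingleton X x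
    X-singleton y with em {y ≡ x}
    ... | yes p = (λ _ → refl) , λ ¬p → contradiction p ¬p
    ... | no ¬p = (λ p → contradiction p ¬p) , λ _ → refl
    X-avoids : ∀ n ξs → (Baire ∷ [] , ξs) ∈ ⟦ proj₁ (outcome n) ⟧ → 0 ≡ X ξs
    X-avoids n (y , tt) y∈ with em {y ≡ x}
    ... | yes refl = contradiction (∈-∪ʳ (single b) seen
            (∈->>= (fibre points (Baire ∷ [])) (single ∘ proj₁)
              (∈-fibre points (∈-⋃ (proj₁ ∘ outcome) n y∈)) (0 , refl))) x∉
    ... | no _ = refl
    x≡b : ∀ nt → x nt ≡ b nt
    x≡b (n , tt) = sym (proj₂ (proj₂ (outcome n)) (low X (X-avoids n) ∷ number ∷ m)
                         (computes (X , n , tt) _ (Ω₁-singleton X n X-singleton)))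

corollary3p30 : (em : ExcludedMiddle 0ℓ) → Extensionality 0ℓ 0ℓ →
    ∀ {σ τ} (Ψ : F σ) (Ξ : F τ) →
    CountablyBased {σ} Ψ → rank τ ≤ 3 →
    ¬ ComputationallyEquivalent
        (total {σ} Ψ ∷ (Ω₁Ty , Ω₁ em) ∷ [])
        (total {σ} Ψ ∷ total {τ} Ξ ∷ [])
corollary3p30 em ext {σ} {τ} Ψ Ξ cb r (_ ∷ Ω₁-computable ∷ [] , _ ∷ Ξ-computable ∷ []) =
  Ω₁-not-computable (totalSlot-matches σ _ Ψ Ψ-based ∷ totalSlot-matches τ r Ξ Ξ-based ∷ [])
    (totalSlot-≢omega σ (proj₁ cb) Ψ Ψ-based ∷ totalSlot-≢omega τ r Ξ Ξ-based ∷ [])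
    Ω₁-computable
  where
  open Classical em ext
  Ψ-based : Based σ Ψ
  Ψ-based = CountablyBased⇒Based {σ} cb
  Ξ-based : Based τ Ξ
  -- `Ω₁` occurs as an oracle here, and is replaced by the based functional `Ξ` in the divergence
  -- argument.
  Ξ-based = computable⇒Based Ξ r (totalSlot-matches σ (proj₁ cb) Ψ Ψ-based ∷ omega ∷ []) Ξ-computable
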